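{- Let $M$ be a minimal dominating set of a finite tree $T$, let $X\subseteq N_2(M)$ and let $A_2=N(X)\cap a_2(M)$. Suppose that $A_2\cup X$ induces a connected subtree of $T$ and that $X$ is an independent set in $T$. Then Algorithm 2 below, run on $M$ and $X$, terminates with a minimal dominating set $M'$ of $T$ with $|M'|\ge|M|-|A_2|+|X|$. Algorithm 2: set $A=N(X)\cap a(M)$, $A_2=N(X)\cap a_2(M)$, $N=N(A)\cap N_1(M)$, and $M'=((M\cup X)\setminus A)\cup N$. For each $x\in X$ in turn: root $T$ at $x$; let $T_x$ be the subtree obtained from $T$ by deleting the vertices of $A_2$ together with all their descendants (with respect to the root $x$); let $M'_x=M'\cap V(T_x)$; let $M''_x$ be the output of Algorithm 1 run on $T_x$ rooted at $x$ with input $M'_x$; set $M'=(M'\setminus M'_x)\cup M''_x$. Return $M'$. Algorithm 1 (input: a tree rooted at a vertex and a dominating set $M_0$ of it): set $i=0$; while $M_i$ is not a minimal dominating set: choose a supported vertex $u_i\in M_i\setminus a(M_i)$ of least depth; let $A_{i+1}$ be the set of vertices of $a_1(M_i)$ adjacent to $u_i$; let $N_{i+1}$ be the set of vertices of $N_1(M_i)$ adjacent to some vertex of $A_{i+1}$; set $M_{i+1}=(M_i\setminus A_{i+1})\cup N_{i+1}$ and increase $i$ by $1$. Return $M_i$.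
   Context: A dominating set of a graph $G=(V,E)$ is a set $S\subseteq V$ with $N[S]=V$ ($N[v]$ closed neighbourhood, $N(v)$ open neighbourhood, $N(A)=\bigcup_{a\in A}N(a)$); it is minimal if no proper subset is dominating. For a dominating set $S$ (of the graph under consideration): $a(S)=\{u\in S: S\setminus\{u\}\text{ is not dominating}\}$; vertices of $S\setminus a(S)$ are called supported; $N_1(S)=\{u\in V\setminus S: |N[u]\cap S|=1\}$; $N_2(S)=\{u\in V\setminus S:|N[u]\cap S|\ge2\}$; $a_1(S)=\{u\in a(S): N[u]\cap N_1(S)\ne\emptyset\}$; $a_2(S)=\{u\in a(S): N[u]\cap N_1(S)=\emptyset\}$. In a tree rooted at $r$, the depth of a vertex is its distance to $r$, and $x$ is a descendant of $y$ if $y$ lies on the path from $x$ to $r$. -}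

module Defs where

open import Data.Nat using (ℕ; zero; suc; _≤_)
open import Data.Fin using (Fin)
open import Data.Fin.Subset using (Subset; _∈_; _∉_; _⊆_; _∩_; _∪_; _─_; _-_; ∣_∣)
open import Data.List using (List; []; _∷_; length; head; last)
open import Data.List.Relation.Unary.Unique.Propositional using (Unique)
import Data.List.Membership.Propositional as LM
open import Data.Maybe using (just)
open import Data.Product using (Σ; ∃; ∃-syntax; _×_; _,_)
open import Data.Sum using (_⊎_)
open import Data.Empty using (⊥)
open import Data.Unit using (⊤)
open import Relation.Nullary using (¬_)
open import Relation.Binary using (Decidable)
open import Relation.Binary.PropositionalEquality using (_≡_; _≢_)
open import Function.Bundles using (_⇔_)

record Graph (n : ℕ) : Set₁ where
  field
    E      : Fin n → Fin n → Set
    E?     : Decidable E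
    sym    : ∀ {u v} → E u v → E v u
    irrefl : ∀ v → ¬ E v v

-- A vertex predicate W describes an induced subgraph G[W].
VSet : ℕ → Set₁
VSet n = Fin n → Set

module _ {n : ℕ} (G : Graph n) where
  open Graph G

  All : VSet n
  All _ = ⊤

  WalkIn : VSet n → List (Fin n) → Set
  WalkIn W []            = ⊥
  WalkIn W (v ∷ [])      = W v
  WalkIn W (v ∷ w ∷ p)   = W v × E v w × WalkIn W (w ∷ p)

  PathFromTo : VSet n → Fin n → Fin n → List (Fin n) → Set
  PathFromTo W u v p = WalkIn W p × Unique p × head p ≡ just u × last p ≡ just v

  Connected : VSet n → Set
  Connected W = ∀ u v → W u → W v → ∃[ p ] PathFromTo W u v p

  IsTree : VSet n → Set
  IsTree W = (∃[ v ] W v) × Connected W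
           × (∀ u v p q → PathFromTo W u v p → PathFromTo W u v q → p ≡ q)

  Depth : VSet n → Fin n → Fin n → ℕ → Set
  Depth W r v k = ∃[ p ] (PathFromTo W v r p × length p ≡ suc k)

  Descendant : VSet n → Fin n → Fin n → Fin n → Set
  Descendant W r x y = ∃[ p ] (PathFromTo W x r p × y LM.∈ p)

  Dom : VSet n → Subset n → Set
  Dom W S = (∀ s → s ∈ S → W s)
          × (∀ v → W v → ∃[ s ] (s ∈ S × W s × (s ≡ v ⊎ E s v)))

  MinDom : VSet n → Subset n → Set
  MinDom W S = Dom W S × (∀ S' → S' ⊆ S → Dom W S' → S ⊆ S')

  InA : VSet n → Subset n → Fin n → Set
  InA W S u = u ∈ S × ¬ Dom W (S - u)

  Supported : VSet n → Subset n → Fin n → Set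
  Supported W S u = u ∈ S × Dom W (S - u)

  InN1 : VSet n → Subset n → Fin n → Set
  InN1 W S u = W u × u ∉ S
             × ∃[ s ] ((s ∈ S × W s × E s u)
                       × (∀ s' → s' ∈ S → W s' → E s' u → s' ≡ s))

  InN2 : VSet n → Subset n → Fin n → Set
  InN2 W S u = W u × u ∉ S
             × ∃[ s ] ∃[ t ] (s ≢ t × s ∈ S × W s × E s u × t ∈ S × W t × E t u)

  InA1 : VSet n → Subset n → Fin n → Set
  InA1 W S u = InA W S u × ∃[ v ] (W v × (v ≡ u ⊎ E u v) × InN1 W S v)

  InA2 : VSet n → Subset n → Fin n → Set
  InA2 W S u = InA W S u × (∀ v → W v → (v ≡ u ⊎ E u v) → ¬ InN1 W S v)

  LeastDepthSupported : VSet n → Fin n → Subset n → Fin n → Set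
  LeastDepthSupported W r M u =
    Supported W M u × ∃[ k ] (Depth W r u k
      × (∀ w k' → Supported W M w → Depth W r w k' → k ≤ k'))

  Step1 : VSet n → Fin n → Subset n → Subset n → Set
  Step1 W r M M' = ¬ MinDom W M × ∃[ u ] (LeastDepthSupported W r M u ×
      let Aᵢ : VSet n
          Aᵢ v = InA1 W M v × E u v
          Nᵢ : VSet n
          Nᵢ v = InN1 W M v × ∃[ a ] (Aᵢ a × E a v)
      in ∀ v → (v ∈ M' ⇔ ((v ∈ M × ¬ Aᵢ v) ⊎ Nᵢ v)))

  -- every run of Algorithm 1 from M is finite and never gets stuck
  data Halts1 (W : VSet n) (r : Fin n) : Subset n → Set where
    done : ∀ {M} → MinDom W M → Halts1 W r M
    step : ∀ {M} → ¬ MinDom W M → (∃[ M' ] Step1 W r M M')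
         → (∀ M' → Step1 W r M M' → Halts1 W r M') → Halts1 W r M

  data Out1 (W : VSet n) (r : Fin n) : Subset n → Subset n → Set where
    stop : ∀ {M} → MinDom W M → Out1 W r M M
    more : ∀ {M M' Mout} → Step1 W r M M' → Out1 W r M' Mout → Out1 W r M Mout

  -- Algorithm 2 (loop part), with A₂ fixed, processing X in the order xs
  -- vertex set of Tₓ : delete A₂ and all descendants (root x)
  Tx : VSet n → Fin n → VSet n
  Tx A₂ x v = ¬ (∃[ a ] (A₂ a × Descendant All x v a))

  Halts2 : VSet n → Subset n → List (Fin n) → Set
  Halts2 A₂ M []       = ⊤
  Halts2 A₂ M (x ∷ xs) =
    ∀ Mx → (∀ v → v ∈ Mx ⇔ (v ∈ M × Tx A₂ x v)) →
      Halts1 (Tx A₂ x) x Mx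
      × (∀ M'' → Out1 (Tx A₂ x) x Mx M'' → Halts2 A₂ ((M ─ Mx) ∪ M'') xs)

  data Out2 (A₂ : VSet n) : Subset n → List (Fin n) → Subset n → Set where
    fin  : ∀ {M} → Out2 A₂ M [] M
    iter : ∀ {M x xs Mx M'' Mout}
         → (∀ v → v ∈ Mx ⇔ (v ∈ M × Tx A₂ x v))
         → Out1 (Tx A₂ x) x Mx M''
         → Out2 A₂ ((M ─ Mx) ∪ M'') xs Mout
         → Out2 A₂ M (x ∷ xs) Mout

{-# OPTIONS --safe #-}
-- A vertex of a dominating set is critical iff it has a private neighbour (possibly itself). For
-- Algorithm 1 the invariant is that every neighbour, in the current set, of a supported vertex lies
-- deeper than that vertex. Then all these neighbours are in a₁ and a step replaces each of them by its
-- private neighbours, so the size does not drop; the treated vertex becomes isolated in the set, and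
-- isolated vertices stay isolated, which gives termination.
-- The set M₀ restricted to Tₓ arises by the same exchange, at x, from (M ∩ Tₓ) ∪ {x}, so the invariant
-- holds initially. The trees Tₓ are disjoint and separated from everything else by A₂, which the
-- current set avoids, so minimality can be checked on each Tₓ and on the untouched rest.

module Submission where

open import Defs
open import Data.Nat using (ℕ; zero; suc; _≤_; _<_; _+_; _∸_; z≤n; s≤s; _<?_)
import Data.Nat.Properties as ℕ
open import Data.Nat.Induction using (<-wellFounded)
open import Induction.WellFounded using (Acc; acc)
open import Data.Fin using (Fin; zero; suc; _≟_)
open import Data.Fin.Properties using (any?; all?; suc-injective)
open import Data.Fin.Subset using (Subset; inside; outside; _∈_; _∉_; _⊆_; _∪_; _─_; _-_; ∣_∣)
open import Data.Fin.Subset.Properties using (_∈?_; drop-there; p─q⊆p; x∈p∧x∉q⇒x∈p─q;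
  x∈p∧x≢y⇒x∈p-y; x∈p⇒∣p-x∣<∣p∣; x∈⁅x⁆; p⊂q⇒∣p∣<∣q∣; p⊆q⇒∣p∣≤∣q∣; ∣p∣≤n; x∈p∪q⁺; x∈p∪q⁻)
open import Data.Vec using ([]; _∷_; tabulate; here; there)
open import Data.Vec.Properties using (lookup⇒[]=; []=⇒lookup; lookup∘tabulate)
open import Data.List using (List; []; _∷_; length; head)
open import Data.List.Relation.Unary.Any using (here; there)
open import Data.List.Relation.Unary.All using ([]) renaming (lookup to All-lookup)
open import Data.List.Relation.Unary.AllPairs using ([]; _∷_)
open import Data.List.Relation.Unary.All.Properties using (¬Any⇒All¬)
open import Data.List.Relation.Unary.Unique.Propositional using (Unique)
import Data.List.Membership.Propositional as LM
import Data.List.Membership.DecPropositional as DecMembership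
open import Data.List.Properties using (∷-injectiveʳ)
open import Data.Maybe using (just)
open import Data.Maybe.Properties using (just-injective)
open import Data.Product using (∃; ∃-syntax; _×_; _,_; proj₁; proj₂)
open import Data.Sum using (_⊎_; inj₁; inj₂)
open import Data.Unit using (tt)
open import Function using (_∘_; id)
open import Function.Bundles using (_⇔_; mk⇔; Equivalence)
open import Relation.Nullary using (¬_; Dec; yes; no; does; ¬?; contradiction)
open import Relation.Nullary.Decidable using (_×-dec_; _⊎-dec_; _→-dec_; dec-true)
open import Relation.Unary using (Decidable)
open import Relation.Binary.PropositionalEquality using (_≡_; _≢_; refl; sym; trans; cong; subst)

open Equivalence using (to; from)

-- Finite subsets: comprehension, minimisation and cardinality.

module _ {n : ℕ} {P : Fin n → Set} (P? : Decidable P) where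

  subsetOf : Subset n
  subsetOf = tabulate (λ v → does (P? v))

  ∈-subsetOf⁺ : ∀ {v} → P v → v ∈ subsetOf
  ∈-subsetOf⁺ {v} p = lookup⇒[]= v subsetOf (trans (lookup∘tabulate _ v) (dec-true (P? v) p))

  ∈-subsetOf⁻ : ∀ {v} → v ∈ subsetOf → P v
  ∈-subsetOf⁻ {v} v∈ with P? v | trans (sym (lookup∘tabulate (λ w → does (P? w)) v)) ([]=⇒lookup v∈)
  ... | yes p | _ = p
  ... | no _  | ()

  least : (f : Fin n → ℕ) → ∃ P → ∃[ u ] (P u × (∀ w → P w → f u ≤ f w))
  least f (u₀ , p₀) = go u₀ p₀ (<-wellFounded (f u₀))
    where
    go : ∀ u → P u → Acc _<_ (f u) → ∃[ v ] (P v × (∀ w → P w → f v ≤ f w))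
    go u p (acc rs) with any? (λ w → P? w ×-dec (f w <? f u))
    ... | yes (w , q , lt) = go w q (rs lt)
    ... | no none = u , p , λ w q → ℕ.≮⇒≥ (λ lt → none (w , q , lt))

x∈p─q⇒x∉q : ∀ {n} (p q : Subset n) {x} → x ∈ p ─ q → x ∉ q
x∈p─q⇒x∉q (_ ∷ p) (inside  ∷ q) {suc x} x∈ (there x∈q) = x∈p─q⇒x∉q p q (drop-there x∈) x∈q
x∈p─q⇒x∉q (_ ∷ p) (outside ∷ q) {suc x} x∈ (there x∈q) = x∈p─q⇒x∉q p q (drop-there x∈) x∈q
x∈p─q⇒x∉q (_ ∷ p) (inside  ∷ q) {zero}  () here

x∈p-y⇒x≢y : ∀ {n} (p : Subset n) {x y} → x ∈ p - y → x ≢ y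
x∈p-y⇒x≢y p x∈ refl = x∈p─q⇒x∉q p _ x∈ (x∈⁅x⁆ _)

∣p∪q∣≤∣p∣+∣q∣ : ∀ {n} (p q : Subset n) → ∣ p ∪ q ∣ ≤ ∣ p ∣ + ∣ q ∣
∣p∪q∣≤∣p∣+∣q∣ [] [] = z≤n
∣p∪q∣≤∣p∣+∣q∣ (inside  ∷ p) (outside ∷ q) = s≤s (∣p∪q∣≤∣p∣+∣q∣ p q)
∣p∪q∣≤∣p∣+∣q∣ (outside ∷ p) (outside ∷ q) = ∣p∪q∣≤∣p∣+∣q∣ p q
∣p∪q∣≤∣p∣+∣q∣ (outside ∷ p) (inside  ∷ q) rewrite ℕ.+-suc ∣ p ∣ ∣ q ∣ = s≤s (∣p∪q∣≤∣p∣+∣q∣ p q)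
∣p∪q∣≤∣p∣+∣q∣ (inside  ∷ p) (inside  ∷ q) rewrite ℕ.+-suc ∣ p ∣ ∣ q ∣ = s≤s (ℕ.m≤n⇒m≤1+n (∣p∪q∣≤∣p∣+∣q∣ p q))

disjoint⇒∣p∣+∣q∣≤∣p∪q∣ : ∀ {n} (p q : Subset n) → (∀ v → v ∈ p → v ∉ q) → ∣ p ∣ + ∣ q ∣ ≤ ∣ p ∪ q ∣
disjoint⇒∣p∣+∣q∣≤∣p∪q∣ [] [] _ = z≤n
disjoint⇒∣p∣+∣q∣≤∣p∪q∣ (s ∷ p) (t ∷ q) disj with disjoint⇒∣p∣+∣q∣≤∣p∪q∣ p q (λ v a b → disj (suc v) (there a) (there b))
disjoint⇒∣p∣+∣q∣≤∣p∪q∣ (inside  ∷ p) (outside ∷ q) disj | ih = s≤s ih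
disjoint⇒∣p∣+∣q∣≤∣p∪q∣ (outside ∷ p) (outside ∷ q) disj | ih = ih
disjoint⇒∣p∣+∣q∣≤∣p∪q∣ (outside ∷ p) (inside  ∷ q) disj | ih rewrite ℕ.+-suc ∣ p ∣ ∣ q ∣ = s≤s ih
disjoint⇒∣p∣+∣q∣≤∣p∪q∣ (inside  ∷ p) (inside  ∷ q) disj | _ = contradiction here (disj zero here)

-- Induction on `p`: the partner of the first element is deleted from `q`, and injectivity keeps the
-- other partners away from it. A relation in place of a function lets each partner come straight
-- from an existence proof.
injection⇒∣p∣≤∣q∣ : ∀ {m n} (p : Subset m) (q : Subset n) (R : Fin m → Fin n → Set)
  → (∀ i → i ∈ p → ∃[ j ] (j ∈ q × R i j))
  → (∀ {i i′ j} → i ∈ p → i′ ∈ p → j ∈ q → R i j → R i′ j → i ≡ i′)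
  → ∣ p ∣ ≤ ∣ q ∣
injection⇒∣p∣≤∣q∣ [] q R tot inj = z≤n
injection⇒∣p∣≤∣q∣ (outside ∷ p) q R tot inj =
  injection⇒∣p∣≤∣q∣ p q (R ∘ suc) (λ i → tot (suc i) ∘ there)
    λ a b c r r′ → suc-injective (inj (there a) (there b) c r r′)
injection⇒∣p∣≤∣q∣ (inside ∷ p) q R tot inj with tot zero here
... | j , j∈q , r = ℕ.≤-trans (s≤s rec) (x∈p⇒∣p-x∣<∣p∣ j∈q)
  where
  tot′ : ∀ i → i ∈ p → ∃[ k ] (k ∈ q - j × R (suc i) k)
  tot′ i i∈p with tot (suc i) (there i∈p)
  ... | k , k∈q , r′ = k , x∈p∧x≢y⇒x∈p-y k∈q k≢j , r′
    where
    k≢j : k ≢ j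
    k≢j refl with inj here (there i∈p) j∈q r r′
    ... | ()
  rec : ∣ p ∣ ≤ ∣ q - j ∣
  rec = injection⇒∣p∣≤∣q∣ p (q - j) (R ∘ suc) tot′
    λ a b c r₁ r₂ → suc-injective (inj (there a) (there b) (p─q⊆p q _ c) r₁ r₂)

-- Domination, criticality and private neighbours.

module _ {n : ℕ} (G : Graph n) where
  open Graph G renaming (sym to E-sym)

  Dominates : Fin n → Fin n → Set
  Dominates s v = s ≡ v ⊎ E s v

  dominates? : ∀ s v → Dec (Dominates s v)
  dominates? s v = (s ≟ v) ⊎-dec E? s v

  -- That `u` dominates `w` is implicit: if `S` is dominating, some member dominates `w`, and it can
  -- only be `u`.
  Private : VSet n → Subset n → Fin n → Set
  Private W S u = ∃[ w ] (W w × (∀ s → s ∈ S → Dominates s w → s ≡ u))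

  module _ {W : VSet n} {S : Subset n} where

    private⇒critical : ∀ {u} → Private W S u → ¬ Dom G W (S - u)
    private⇒critical (w , Ww , only) (_ , cover) with cover w Ww
    ... | s , s∈ , _ , sw = x∈p-y⇒x≢y S s∈ (only s (p─q⊆p S _ s∈) sw)

    privates⇒minDom : Dom G W S → (∀ u → u ∈ S → Private W S u) → MinDom G W S
    privates⇒minDom dom priv = dom , minimal
      where
      minimal : ∀ S′ → S′ ⊆ S → Dom G W S′ → S ⊆ S′
      minimal S′ S′⊆S (_ , cover) {u} u∈S with priv u u∈S
      ... | w , Ww , only with cover w Ww
      ... | s , s∈S′ , _ , sw = subst (_∈ S′) (only s (S′⊆S s∈S′) sw) s∈S′

    module _ (W? : Decidable W) where

      -- The search for a private neighbour is finite. If it fails, every vertex of `W` has a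
      -- dominator different from `u`, since otherwise that vertex would be private to `u`.
      critical-or-supported : Dom G W S → ∀ u → Private W S u ⊎ Dom G W (S - u)
      critical-or-supported (S⊆W , cover) u
        with any? (λ w → W? w ×-dec all? (λ s → (s ∈? S) →-dec (dominates? s w →-dec (s ≟ u))))
      ... | yes priv = inj₁ priv
      ... | no none = inj₂ ((λ s s∈ → S⊆W s (p─q⊆p S _ s∈)) , cover′)
        where
        cover′ : ∀ v → W v → ∃[ s ] (s ∈ S - u × W s × Dominates s v)
        cover′ v Wv with any? (λ s → (s ∈? (S - u)) ×-dec (W? s ×-dec dominates? s v))
        ... | yes found = found
        ... | no nothing = contradiction (v , Wv , only) none
          where
          only : ∀ s → s ∈ S → Dominates s v → s ≡ u
          only s s∈S sv with s ≟ u
          ... | yes eq = eq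
          ... | no s≢u = contradiction (s , x∈p∧x≢y⇒x∈p-y s∈S s≢u , S⊆W s s∈S , sv) nothing

      minDom⇒private : MinDom G W S → ∀ u → u ∈ S → Private W S u
      minDom⇒private (dom , minimal) u u∈S with critical-or-supported dom u
      ... | inj₁ priv = priv
      ... | inj₂ dom′ = contradiction refl (x∈p-y⇒x≢y S (minimal (S - u) (p─q⊆p S _) dom′ u∈S))

      inN1? : ∀ v → Dec (InN1 G W S v)
      inN1? v = W? v ×-dec (¬? (v ∈? S) ×-dec any? (λ s →
        ((s ∈? S) ×-dec (W? s ×-dec E? s v))
        ×-dec all? (λ s′ → (s′ ∈? S) →-dec (W? s′ →-dec (E? s′ v →-dec (s′ ≟ s))))))

    -- The neighbour `u` in `S` also dominates `y`, so `y` is not its own private neighbour. The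
    -- private vertex `w` therefore differs from `y` and lies outside `S`, with `y` as its only
    -- neighbour in `S`.
    adjacent-private⇒N1 : Dom G W S → ∀ {u y} → u ∈ S → y ∈ S → E u y → Private W S y
      → ∃[ w ] (InN1 G W S w × E y w)
    adjacent-private⇒N1 (S⊆W , cover) {u} {y} u∈S y∈S Euy (w , Ww , only) with cover w Ww
    ... | s , s∈S , _ , sw with only s s∈S sw
    ... | refl with sw
    ... | inj₁ refl = contradiction (subst (λ z → E z y) (only u u∈S (inj₂ Euy)) Euy) (irrefl y)
    ... | inj₂ Eyw = w , (Ww , w∉S , y , (y∈S , S⊆W y y∈S , Eyw) , λ s′ s′∈S _ Es′w → only s′ s′∈S (inj₂ Es′w)) , Eyw
      where
      w∉S : w ∉ S
      w∉S w∈S = irrefl y (subst (E y) (only w w∈S (inj₁ refl)) Eyw)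

    adjacent-N1-unique : Dom G W S → ∀ {v s t} → InN1 G W S v → s ∈ S → E s v → t ∈ S → E t v → s ≡ t
    adjacent-N1-unique (S⊆W , _) (_ , _ , _ , _ , uniq) s∈S Esv t∈S Etv =
      trans (uniq _ s∈S (S⊆W _ s∈S) Esv) (sym (uniq _ t∈S (S⊆W _ t∈S) Etv))

  -- The exchange at one vertex, relative to a depth function with unique parents.

  module Descent
    (W : VSet n) (W? : Decidable W) (d : Fin n → ℕ)
    (edge-depth : ∀ {u v} → E u v → d u ≡ suc (d v) ⊎ d v ≡ suc (d u))
    (parent-unique : ∀ {u v w} → E u v → E u w → d v < d u → d w < d u → v ≡ w)
    where

    -- The unique parent of `b` is `a`, so any other neighbour of `b` is a child.
    descend : ∀ {a b c} → E a b → E b c → a ≢ c → d a < d b → d b < d c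
    descend Eab Ebc a≢c lt with edge-depth Ebc
    ... | inj₂ eq = ℕ.≤-reflexive (sym eq)
    ... | inj₁ eq = contradiction (parent-unique (E-sym Eab) Ebc lt (ℕ.≤-reflexive (sym eq))) a≢c

    Downward : Subset n → Set
    Downward S = ∀ z y → Supported G W S z → y ∈ S → E z y → d z < d y

    -- When the supported vertices look downward, all neighbours of u in S lie in a₁(S), so this is Step1 at u.
    New : Subset n → Fin n → Fin n → Set
    New S u v = InN1 G W S v × ∃[ a ] (a ∈ S × E u a × E a v)

    Next : Subset n → Fin n → Subset n → Set
    Next S u S′ = ∀ v → v ∈ S′ ⇔ ((v ∈ S × ¬ E u v) ⊎ New S u v)

    Isolated : Subset n → Fin n → Set
    Isolated S z = z ∈ S × (∀ y → y ∈ S → ¬ E z y)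

    isolated? : ∀ S → Decidable (Isolated S)
    isolated? S z = (z ∈? S) ×-dec all? (λ y → (y ∈? S) →-dec ¬? (E? z y))

    -- The hypothesis `below` speaks of the single vertex `u`, so that the module serves both for a
    -- step of Algorithm 1 and for the exchange at a root `x`, which may fail to be supported.
    module Exchange {S S′ : Subset n} {u : Fin n} (dom : Dom G W S) (u∈S : u ∈ S)
      (below : ∀ y → y ∈ S → E u y → d u < d y) (next : Next S u S′) where

      keep : ∀ {v} → v ∈ S → ¬ E u v → v ∈ S′
      keep v∈S ¬Euv = from (next _) (inj₁ (v∈S , ¬Euv))

      new-nbr : ∀ {v s} → New S u v → s ∈ S → E s v → E u s
      new-nbr (n1 , a , a∈S , Eua , Eav) s∈S Esv =
        subst (E u) (adjacent-N1-unique dom n1 a∈S Eav s∈S Esv) Eua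

      grandchild : ∀ {a v} → a ∈ S → E u a → E a v → v ∉ S → d a < d v
      grandchild a∈S Eua Eav v∉S = descend Eua Eav (λ eq → v∉S (subst (_∈ S) eq u∈S)) (below _ a∈S Eua)

      -- The deeper vertex `w` would have two parents, the removed vertex `a` in `S` and the new
      -- vertex `v` outside `S`.
      new-new : ∀ {v w} → New S u v → New S u w → E v w → ¬ (d v < d w)
      new-new (n1 , _) ((_ , w∉S , _) , a , a∈S , Eua , Eaw) Evw lt =
        proj₁ (proj₂ n1) (subst (_∈ S)
          (parent-unique (E-sym Eaw) (E-sym Evw) (grandchild a∈S Eua Eaw w∉S) lt) a∈S)

      new-isolated : ∀ {z y} → New S u z → y ∈ S′ → ¬ E z y
      new-isolated {z} {y} nz y∈ Ezy with to (next y) y∈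
      ... | inj₁ (y∈S , ¬Euy) = ¬Euy (new-nbr nz y∈S (E-sym Ezy))
      ... | inj₂ ny with edge-depth Ezy
      ... | inj₁ eq = new-new ny nz (E-sym Ezy) (ℕ.≤-reflexive (sym eq))
      ... | inj₂ eq = new-new nz ny Ezy (ℕ.≤-reflexive (sym eq))

      S′⊆W : ∀ s → s ∈ S′ → W s
      S′⊆W s s∈ with to (next s) s∈
      ... | inj₁ (s∈S , _) = proj₁ dom s s∈S
      ... | inj₂ ((Ws , _) , _) = Ws

      -- The critical case is a vertex `t` outside `S` whose dominator `s` is removed. If `s` is its
      -- only neighbour in `S`, then `t` itself is new. Otherwise another neighbour `s′` survives,
      -- because two removed neighbours would both be the parent of `t`.
      cover : ∀ t → W t → ∃[ s ] (s ∈ S′ × Dominates s t)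
      cover t Wt with t ∈? S
      cover t Wt | yes t∈S with E? u t
      ... | no ¬Eut = t , keep t∈S ¬Eut , inj₁ refl
      ... | yes Eut = u , keep u∈S (irrefl u) , inj₂ Eut
      cover t Wt | no t∉S with proj₂ dom t Wt
      ... | s , s∈S , _ , inj₁ refl = contradiction s∈S t∉S
      ... | s , s∈S , Ws , inj₂ Est with E? u s
      ... | no ¬Eus = s , keep s∈S ¬Eus , inj₂ Est
      ... | yes Eus with any? (λ s′ → (s′ ∈? S) ×-dec (¬? (s′ ≟ s) ×-dec E? s′ t))
      ... | no none = t , from (next t) (inj₂ ((Wt , t∉S , s , (s∈S , Ws , Est) , only) , s , s∈S , Eus , Est)) , inj₁ refl
        where
        only : ∀ s′ → s′ ∈ S → W s′ → E s′ t → s′ ≡ s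
        only s′ s′∈S _ Es′t with s′ ≟ s
        ... | yes eq = eq
        ... | no neq = contradiction (s′ , s′∈S , neq , Es′t) none
      ... | yes (s′ , s′∈S , neq , Es′t) with E? u s′
      ... | no ¬Eus′ = s′ , keep s′∈S ¬Eus′ , inj₂ Es′t
      ... | yes Eus′ = contradiction (parent-unique (E-sym Es′t) (E-sym Est)
              (grandchild s′∈S Eus′ Es′t t∉S) (grandchild s∈S Eus Est t∉S)) neq

      dom′ : Dom G W S′
      dom′ = S′⊆W , λ t Wt → let s , s∈ , st = cover t Wt in s , s∈ , S′⊆W s s∈ , st

      -- A vertex z that becomes supported has lost a private neighbour w to a new vertex s,
      -- so u, a, s, w, z is a descending path.
      downward′ : Downward S → Downward S′
      downward′ down z y (z∈ , domz) y∈ Ezy with to (next z) z∈ | to (next y) y∈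
      ... | inj₂ nz | _ = contradiction Ezy (new-isolated nz y∈)
      ... | inj₁ _ | inj₂ ny = contradiction (E-sym Ezy) (new-isolated ny z∈)
      ... | inj₁ (z∈S , ¬Euz) | inj₁ (y∈S , _) with critical-or-supported W? dom z
      ... | inj₂ supp = down z y (z∈S , supp) y∈S Ezy
      ... | inj₁ priv with adjacent-private⇒N1 dom y∈S z∈S (E-sym Ezy) priv
      ... | w , n1@(Ww , w∉S , _) , Ezw with proj₂ domz w Ww
      ... | s , s∈- , _ , sw with to (next s) (p─q⊆p S′ _ s∈-) | sw
      ... | inj₁ (s∈S , _) | inj₁ refl = contradiction s∈S w∉S
      ... | inj₁ (s∈S , _) | inj₂ Esw = contradiction (adjacent-N1-unique dom n1 s∈S Esw z∈S Ezw) (x∈p-y⇒x≢y S′ s∈-)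
      ... | inj₂ nw | inj₁ refl = contradiction (new-nbr nw z∈S Ezw) ¬Euz
      ... | inj₂ ((_ , s∉S , _) , a , a∈S , Eua , Eas) | inj₂ Esw =
        descend (E-sym Ezw) Ezy (λ { refl → w∉S y∈S })
          (descend Esw (E-sym Ezw) (λ { refl → s∉S z∈S })
            (descend Eas Esw (λ { refl → w∉S a∈S }) (grandchild a∈S Eua Eas s∉S)))

      -- A new vertex next to `z` would, by `new-nbr`, make `z` a neighbour of `u`, which is itself
      -- in `S`.
      isolated-mono : ∀ z → Isolated S z → Isolated S′ z
      isolated-mono z (z∈S , iso) = keep z∈S (iso u u∈S ∘ E-sym) , iso′
        where
        iso′ : ∀ y → y ∈ S′ → ¬ E z y
        iso′ y y∈ Ezy with to (next y) y∈
        ... | inj₁ (y∈S , _) = iso y y∈S Ezy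
        ... | inj₂ ny = iso u u∈S (E-sym (new-nbr ny z∈S Ezy))

      isolated-new : Isolated S′ u
      isolated-new = keep u∈S (irrefl u) , iso
        where
        iso : ∀ y → y ∈ S′ → ¬ E u y
        iso y y∈ Euy with to (next y) y∈
        ... | inj₁ (_ , ¬Euy) = ¬Euy Euy
        ... | inj₂ ny = irrefl u (new-nbr ny u∈S Euy)

    -- Algorithm 1: invariant, size and termination.

    module Algorithm1 (r : Fin n) (r-depth : d r ≡ 0)
      (depth-exists : ∀ v → W v → Depth G W r v (d v))
      (depth-unique : ∀ v k → Depth G W r v k → k ≡ d v)
      where

      -- The root is tracked because in Algorithm 2 the roots must finally dominate the vertices of
      -- `A₂`.
      Good : Subset n → Set
      Good S = Dom G W S × Downward S × r ∈ S

      module _ {S : Subset n} (good : Good S) {u : Fin n} (supp : Supported G W S u) where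

        private
          dom = proj₁ good
          down = proj₁ (proj₂ good)
          u∈S = proj₁ supp

        -- If `y` were supported as well, the invariant would put each of `u` and `y` strictly
        -- deeper than the other.
        neighbour-N1 : ∀ {y} → y ∈ S → E u y → ∃[ w ] (InN1 G W S w × E y w)
        neighbour-N1 {y} y∈S Euy with critical-or-supported W? dom y
        ... | inj₁ priv = adjacent-private⇒N1 dom u∈S y∈S Euy priv
        ... | inj₂ supp′ = contradiction (down u y supp y∈S Euy) (ℕ.<-asym (down y u (y∈S , supp′) u∈S (E-sym Euy)))

        neighbour-A1 : ∀ {y} → y ∈ S → E u y → InA1 G W S y
        neighbour-A1 {y} y∈S Euy with critical-or-supported W? dom y | neighbour-N1 y∈S Euy
        ... | inj₁ priv | w , n1 , Eyw = (y∈S , private⇒critical priv) , w , proj₁ n1 , inj₂ Eyw , n1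
        ... | inj₂ supp′ | _ = contradiction (down u y supp y∈S Euy) (ℕ.<-asym (down y u (y∈S , supp′) u∈S (E-sym Euy)))

        StepSpec : Fin n → Set
        StepSpec v = (v ∈ S × ¬ (InA1 G W S v × E u v))
                   ⊎ (InN1 G W S v × ∃[ a ] ((InA1 G W S a × E u a) × E a v))

        spec⇔next : ∀ v → StepSpec v ⇔ ((v ∈ S × ¬ E u v) ⊎ New S u v)
        spec⇔next v = mk⇔
          (λ { (inj₁ (v∈S , ¬A)) → inj₁ (v∈S , λ Euv → ¬A (neighbour-A1 v∈S Euv , Euv))
             ; (inj₂ (n1 , a , (a1 , Eua) , Eav)) → inj₂ (n1 , a , proj₁ (proj₁ a1) , Eua , Eav) })
          (λ { (inj₁ (v∈S , ¬Euv)) → inj₁ (v∈S , ¬Euv ∘ proj₂)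
             ; (inj₂ (n1 , a , a∈S , Eua , Eav)) → inj₂ (n1 , a , (neighbour-A1 a∈S Eua , Eua) , Eav) })

        next-exists : ∃[ S′ ] (∀ v → v ∈ S′ ⇔ StepSpec v)
        next-exists = subsetOf step? , λ v → mk⇔ (from (spec⇔next v) ∘ ∈-subsetOf⁻ step?)
                                                 (∈-subsetOf⁺ step? ∘ to (spec⇔next v))
          where
          step? : Decidable (λ v → (v ∈ S × ¬ E u v) ⊎ New S u v)
          step? v = ((v ∈? S) ×-dec ¬? (E? u v))
            ⊎-dec (inN1? W? v ×-dec any? (λ a → (a ∈? S) ×-dec (E? u a ×-dec E? a v)))

        module _ {S′ : Subset n} (spec : ∀ v → v ∈ S′ ⇔ StepSpec v) where

          private
            next : Next S u S′
            next v = mk⇔ (to (spec⇔next v) ∘ to (spec v)) (from (spec v) ∘ from (spec⇔next v))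

          open Exchange dom u∈S (λ y → down u y supp) next

          good′ : Good S′
          good′ = dom′ , downward′ down , keep (proj₂ (proj₂ good)) ¬Eur
            where
            -- The root has depth 0, so it cannot lie deeper than `u` and is never removed.
            ¬Eur : ¬ E u r
            ¬Eur Eur = ℕ.n≮0 (subst (d u <_) r-depth (down u r supp (proj₂ (proj₂ good)) Eur))

          -- Kept vertices are matched with themselves and removed ones with a neighbour in N₁(S). A
          -- vertex of N₁(S) lies outside `S` and has one neighbour there, so no partner is used
          -- twice.
          size-mono : ∣ S ∣ ≤ ∣ S′ ∣
          size-mono = injection⇒∣p∣≤∣q∣ S S′ R total injective
            where
            R : Fin n → Fin n → Set
            R i j = i ≡ j ⊎ (InN1 G W S j × E i j)
            total : ∀ i → i ∈ S → ∃[ j ] (j ∈ S′ × R i j)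
            total i i∈S with E? u i
            ... | no ¬Eui = i , keep i∈S ¬Eui , inj₁ refl
            ... | yes Eui with neighbour-N1 i∈S Eui
            ... | w , n1 , Eiw = w , from (next w) (inj₂ (n1 , i , i∈S , Eui , Eiw)) , inj₂ (n1 , Eiw)
            injective : ∀ {i i′ j} → i ∈ S → i′ ∈ S → j ∈ S′ → R i j → R i′ j → i ≡ i′
            injective _ _ _ (inj₁ refl) (inj₁ refl) = refl
            injective i∈ _ _ (inj₁ refl) (inj₂ ((_ , ∉S , _) , _)) = contradiction i∈ ∉S
            injective _ i′∈ _ (inj₂ ((_ , ∉S , _) , _)) (inj₁ refl) = contradiction i′∈ ∉S
            injective i∈ i′∈ _ (inj₂ (n1 , e)) (inj₂ (_ , e′)) = adjacent-N1-unique dom n1 i∈ e i′∈ e′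

          isolated-grows : ∣ subsetOf (isolated? S) ∣ < ∣ subsetOf (isolated? S′) ∣
          isolated-grows = p⊂q⇒∣p∣<∣q∣
            ( (λ z∈ → ∈-subsetOf⁺ (isolated? S′) (isolated-mono _ (∈-subsetOf⁻ (isolated? S) z∈)))
            , u , ∈-subsetOf⁺ (isolated? S′) isolated-new , ¬iso ∘ ∈-subsetOf⁻ (isolated? S))
            where
            -- As `u` is supported, another member of `S` dominates it, and that member is a
            -- neighbour.
            ¬iso : ¬ Isolated S u
            ¬iso (_ , iso) with proj₂ (proj₂ supp) u (proj₁ dom u u∈S)
            ... | s , s∈ , _ , inj₁ eq = x∈p-y⇒x≢y S s∈ eq
            ... | s , s∈ , _ , inj₂ Esu = iso s (p─q⊆p S _ s∈) (E-sym Esu)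

      out1-spec : ∀ {S S′} → Good S → Out1 G W r S S′ → MinDom G W S′ × r ∈ S′ × ∣ S ∣ ≤ ∣ S′ ∣
      out1-spec good (stop min) = min , proj₂ (proj₂ good) , ℕ.≤-refl
      out1-spec good (more (_ , _ , (supp , _) , spec) out) with out1-spec (good′ good supp spec) out
      ... | min , r∈ , le = min , r∈ , ℕ.≤-trans (size-mono good supp spec) le

      supported? : ∀ {S} → Dom G W S → Decidable (Supported G W S)
      supported? {S} dom u with u ∈? S | critical-or-supported W? dom u
      ... | no u∉S | _ = no (u∉S ∘ proj₁)
      ... | yes _ | inj₁ priv = no (private⇒critical priv ∘ proj₂)
      ... | yes u∈S | inj₂ dom′ = yes (u∈S , dom′)

      -- Every step isolates at least one more vertex, and at most `n` can be isolated, so `k`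
      -- bounds the remaining steps. Strictness makes zero fuel absurd.
      halts1-fuel : ∀ k {S} → Good S → n < k + ∣ subsetOf (isolated? S) ∣ → Halts1 G W r S
      halts1-fuel zero {S} good lt = contradiction (∣p∣≤n (subsetOf (isolated? S))) (ℕ.<⇒≱ lt)
      halts1-fuel (suc k) {S} good@(dom , _) lt with any? (supported? dom)
      ... | no none = done (privates⇒minDom dom critical)
        where
        critical : ∀ u → u ∈ S → Private W S u
        critical u u∈S with critical-or-supported W? dom u
        ... | inj₁ priv = priv
        ... | inj₂ supp = contradiction (u , u∈S , supp) none
      ... | yes some with least (supported? dom) d some
      ... | u , supp@(u∈S , dom-u) , low with next-exists good supp
      ... | S₁ , spec₁ = step ¬min (S₁ , ¬min , u , lds , spec₁) rest
        where
        ¬min : ¬ MinDom G W S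
        ¬min min = private⇒critical (minDom⇒private W? min u u∈S) dom-u
        lds : LeastDepthSupported G W r S u
        lds = supp , d u , depth-exists u (proj₁ dom u u∈S) ,
          λ w k′ sw dw → subst (d u ≤_) (sym (depth-unique w k′ dw)) (low w sw)
        rest : ∀ S′ → Step1 G W r S S′ → Halts1 G W r S′
        rest S′ (_ , v , (suppv , _) , spec) = halts1-fuel k (good′ good suppv spec)
          (ℕ.≤-trans lt (ℕ.≤-trans (ℕ.≤-reflexive (sym (ℕ.+-suc k _))) (ℕ.+-monoʳ-≤ k (isolated-grows good suppv spec))))

      halts1 : ∀ {S} → Good S → Halts1 G W r S
      halts1 good = halts1-fuel (suc n) good (ℕ.m≤m+n (suc n) _)

  -- Paths, depths and cut subtrees in a rooted tree.

  walk-member : ∀ {W v} p → WalkIn G W p → v LM.∈ p → W v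
  walk-member (_ ∷ [])    Wv (here refl) = Wv
  walk-member (_ ∷ _ ∷ _) (Wv , _) (here refl) = Wv
  walk-member (_ ∷ _ ∷ p) (_ , _ , walk) (there v∈) = walk-member (_ ∷ p) walk v∈

  walk-restrict : ∀ {W W′ : VSet n} p → (∀ {v} → v LM.∈ p → W′ v) → WalkIn G W p → WalkIn G W′ p
  walk-restrict (_ ∷ [])    sub _ = sub (here refl)
  walk-restrict (_ ∷ _ ∷ p) sub (_ , e , walk) = sub (here refl) , e , walk-restrict (_ ∷ p) (sub ∘ there) walk

  start-∈ : ∀ {W u v} p → PathFromTo G W u v p → u LM.∈ p
  start-∈ (_ ∷ _) (_ , _ , refl , _) = here refl

  cons-path : ∀ {W u v r p} → E u v → W u → u LM.∉ p → PathFromTo G W v r p → PathFromTo G W u r (u ∷ p)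
  cons-path {p = _ ∷ _} Euv Wu u∉p (walk , uniq , refl , l) = (Wu , Euv , walk) , ¬Any⇒All¬ _ u∉p ∷ uniq , refl , l

  -- The last component says that a proper suffix misses the old starting vertex, so that this
  -- vertex can be prepended again without repetition.
  path-suffix : ∀ {W u v r} p → PathFromTo G W v r p → u LM.∈ p
    → ∃[ q ] (PathFromTo G W u r q × (∀ {w} → w LM.∈ q → w LM.∈ p) × (u ≢ v → v LM.∉ q))
  path-suffix (w ∷ p) path@(_ , _ , refl , _) (here refl) = w ∷ p , path , id , λ ne → contradiction refl ne
  path-suffix (_ ∷ w ∷ p) ((_ , _ , walk) , (v∉ ∷ uniq) , refl , l) (there u∈)
    with path-suffix (w ∷ p) (walk , uniq , refl , l) u∈
  ... | q , path , q⊆p , _ = q , path , there ∘ q⊆p , λ _ v∈q → All-lookup v∉ (q⊆p v∈q) refl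

  module RootedTree (tree : IsTree G (All G)) (r : Fin n) where

    open DecMembership (_≟_ {n}) using () renaming (_∈?_ to _∈ˡ?_)

    path : Fin n → List (Fin n)
    path v = proj₁ (proj₁ (proj₂ tree) v r tt tt)

    path-is : ∀ v → PathFromTo G (All G) v r (path v)
    path-is v = proj₂ (proj₁ (proj₂ tree) v r tt tt)

    -- A path inside `W` is also a path of the whole tree. Hence depths measured in a subtree agree
    -- with depths in the tree.
    path-unique : ∀ {W v p} → PathFromTo G W v r p → p ≡ path v
    path-unique {p = p} (walk , rest) =
      proj₂ (proj₂ tree) _ r p _ (walk-restrict p (λ _ → tt) walk , rest) (path-is _)

    start-∈-path : ∀ v → v LM.∈ path v
    start-∈-path v = start-∈ (path v) (path-is v)

    path-⊆ : ∀ {u v w} → u LM.∈ path v → w LM.∈ path u → w LM.∈ path v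
    path-⊆ {u} {v} {w} u∈ w∈ with path-suffix (path v) (path-is v) u∈
    ... | q , is-path , q⊆ , _ = q⊆ (subst (w LM.∈_) (sym (path-unique is-path)) w∈)

    -- If `u` is off the path of `v`, prepend `u` to it. Otherwise the suffix from `u` misses `v`,
    -- and prepending `v` gives the path of `v`, by uniqueness.
    edge-path : ∀ {u v} → E u v → path u ≡ u ∷ path v ⊎ path v ≡ v ∷ path u
    edge-path {u} {v} Euv with u ∈ˡ? path v
    ... | no u∉ = inj₁ (sym (path-unique (cons-path Euv tt u∉ (path-is v))))
    ... | yes u∈ with path-suffix (path v) (path-is v) u∈
    ... | q , is-path , _ , v∉ with path-unique is-path
    ... | refl = inj₂ (sym (path-unique (cons-path (E-sym Euv) tt (v∉ λ { refl → irrefl u Euv }) is-path)))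

    -- `path v` lists both of its ends, so its length exceeds the number of edges by one.
    depth : Fin n → ℕ
    depth v = length (path v) ∸ 1

    length-path : ∀ v → length (path v) ≡ suc (depth v)
    length-path v with path v | start-∈-path v
    ... | _ ∷ _ | _ = refl

    cons-depth : ∀ {u v} → path u ≡ u ∷ path v → depth u ≡ suc (depth v)
    cons-depth {u} {v} eq = trans (cong (λ p → length p ∸ 1) eq) (length-path v)

    edge-depth : ∀ {u v} → E u v → depth u ≡ suc (depth v) ⊎ depth v ≡ suc (depth u)
    edge-depth Euv with edge-path Euv
    ... | inj₁ eq = inj₁ (cons-depth eq)
    ... | inj₂ eq = inj₂ (cons-depth eq)

    parent-path : ∀ {u v} → E u v → depth v < depth u → path u ≡ u ∷ path v
    parent-path Euv lt with edge-path Euv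
    ... | inj₁ eq = eq
    ... | inj₂ eq = contradiction (ℕ.≤-reflexive (sym (cons-depth eq))) (ℕ.<-asym lt)

    path-injective : ∀ {v w} → path v ≡ path w → v ≡ w
    path-injective {v} {w} eq = just-injective
      (trans (sym (proj₁ (proj₂ (proj₂ (path-is v))))) (trans (cong head eq) (proj₁ (proj₂ (proj₂ (path-is w))))))

    parent-unique : ∀ {u v w} → E u v → E u w → depth v < depth u → depth w < depth u → v ≡ w
    parent-unique Euv Euw lt lt′ = path-injective
      (∷-injectiveʳ (trans (sym (parent-path Euv lt)) (parent-path Euw lt′)))

    path-root : path r ≡ r ∷ []
    path-root = sym (path-unique {W = All G} (tt , [] ∷ [] , refl , refl))

    root-depth : depth r ≡ 0
    root-depth = cong (λ p → length p ∸ 1) path-root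

    module Cut (A : Subset n) where

      T : VSet n
      T = Tx G (λ v → v ∈ A) r

      -- By uniqueness of paths, being a descendant of `a` means that `a` lies on the chosen
      -- `path v`. This turns membership in `T` into a decidable condition on one list.
      T⁺ : ∀ {v} → (∀ {a} → a LM.∈ path v → a ∉ A) → T v
      T⁺ avoid (a , a∈A , p , is-path , a∈p) = avoid (subst (a LM.∈_) (path-unique is-path) a∈p) a∈A

      T⁻ : ∀ {v a} → T v → a LM.∈ path v → a ∉ A
      T⁻ {v} t a∈ a∈A = t (_ , a∈A , path v , path-is v , a∈)

      T? : Decidable T
      T? v with any? (λ a → (a ∈? A) ×-dec (a ∈ˡ? path v))
      ... | yes (a , a∈A , a∈) = no λ t → T⁻ t a∈ a∈A
      ... | no none = yes (T⁺ λ a∈ a∈A → none (_ , a∈A , a∈))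

      T⇒∉ : ∀ {v} → T v → v ∉ A
      T⇒∉ t = T⁻ t (start-∈-path _)

      root∈T : r ∉ A → T r
      root∈T r∉A = T⁺ λ a∈ → avoid (subst (_ LM.∈_) path-root a∈)
        where
        avoid : ∀ {a} → a LM.∈ r ∷ [] → a ∉ A
        avoid (here refl) = r∉A

      -- The path of `v` is either the tail of the path of `u` or that path with `v` in front, so
      -- only `v` itself could bring in a vertex of `A`.
      T-closed : ∀ {u v} → T u → E u v → v ∉ A → T v
      T-closed {u} {v} t Euv v∉A with edge-path Euv
      ... | inj₁ eq = T⁺ λ a∈ → T⁻ t (subst (_ LM.∈_) (sym eq) (there a∈))
      ... | inj₂ eq = T⁺ λ a∈ → avoid (subst (_ LM.∈_) eq a∈)
        where
        avoid : ∀ {a} → a LM.∈ v ∷ path u → a ∉ A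
        avoid (here refl) = v∉A
        avoid (there a∈) = T⁻ t a∈

      T-walk : ∀ {u v W} p → PathFromTo G W u v p → (∀ {a} → a LM.∈ p → a ∉ A) → T u → T v
      T-walk (_ ∷ [])    (_ , _ , refl , refl) _ t = t
      T-walk (_ ∷ w ∷ p) ((_ , e , walk) , (_ ∷ uniq) , refl , l) avoid t =
        T-walk (w ∷ p) (walk , uniq , refl , l) (avoid ∘ there) (T-closed t e (avoid (there (here refl))))

      depth-exists : ∀ v → T v → Depth G T r v (depth v)
      depth-exists v t = path v , (walk-restrict (path v) inT (proj₁ (path-is v)) , proj₂ (path-is v)) , length-path v
        where
        inT : ∀ {w} → w LM.∈ path v → T w
        inT w∈ = T⁺ λ a∈ → T⁻ t (path-⊆ w∈ a∈)

      depth-unique : ∀ v k → Depth G T r v k → k ≡ depth v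
      depth-unique v k (p , is-path , len) = ℕ.suc-injective
        (trans (sym len) (trans (cong length (path-unique is-path)) (length-path v)))

-- Algorithm 2: the sets `A₂` and `M₀`.

module Algorithm2 {n : ℕ} (G : Graph n) (tree : IsTree G (All G))
  (M : Subset n) (minM : MinDom G (All G) M)
  (X : Subset n) (X⊆N2 : ∀ x → x ∈ X → InN2 G (All G) M x)
  (independent : ∀ x y → x ∈ X → y ∈ X → ¬ Graph.E G x y)
  (A₂ : Subset n)
  (A₂-spec : ∀ v → v ∈ A₂ ⇔ (InA2 G (All G) M v × ∃[ x ] (x ∈ X × Graph.E G x v)))
  (connected : Connected G (λ v → v ∈ A₂ ⊎ v ∈ X))
  (M₀ : Subset n)
  (M₀-spec : ∀ v → v ∈ M₀ ⇔
         (((v ∈ M ⊎ v ∈ X)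
            × ¬ (InA G (All G) M v × (∃[ x ] (x ∈ X × Graph.E G x v))))
         ⊎ (InN1 G (All G) M v
            × ∃[ a ] ((InA G (All G) M a × ∃[ x ] (x ∈ X × Graph.E G x a))
                      × Graph.E G a v))))
  where

  open Graph G renaming (sym to E-sym)

  every? : Decidable (All G)
  every? _ = yes tt

  domM : Dom G (All G) M
  domM = proj₁ minM

  N1 : Fin n → Set
  N1 = InN1 G (All G) M

  NX : Fin n → Set
  NX v = ∃[ x ] (x ∈ X × E x v)

  nx? : Decidable NX
  nx? v = any? (λ x → (x ∈? X) ×-dec E? x v)

  X∉M : ∀ {x} → x ∈ X → x ∉ M
  X∉M x∈X = proj₁ (proj₂ (X⊆N2 _ x∈X))

  N1∉M : ∀ {v} → N1 v → v ∉ M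
  N1∉M n1 = proj₁ (proj₂ n1)

  N1∉X : ∀ {v} → N1 v → v ∉ X
  N1∉X n1 v∈X with X⊆N2 _ v∈X
  ... | _ , _ , s , t , s≢t , s∈M , _ , Esv , t∈M , _ , Etv = s≢t (adjacent-N1-unique G domM n1 s∈M Esv t∈M Etv)

  privateM : ∀ {v} → v ∈ M → Private G (All G) M v
  privateM = minDom⇒private G every? minM _

  M⇒InA : ∀ {v} → v ∈ M → InA G (All G) M v
  M⇒InA v∈M = v∈M , private⇒critical G (privateM v∈M)

  A₂⊆M : A₂ ⊆ M
  A₂⊆M a∈ = proj₁ (proj₁ (proj₁ (to (A₂-spec _) a∈)))

  A₂⊆NX : ∀ {a} → a ∈ A₂ → NX a
  A₂⊆NX a∈ = proj₂ (to (A₂-spec _) a∈)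

  A₂≁N1 : ∀ {a v} → a ∈ A₂ → E a v → ¬ N1 v
  A₂≁N1 a∈ Eav = proj₂ (proj₁ (to (A₂-spec _) a∈)) _ tt (inj₂ Eav)

  X∉A₂ : ∀ {x} → x ∈ X → x ∉ A₂
  X∉A₂ x∈X = X∉M x∈X ∘ A₂⊆M

  -- All of `M` is critical by minimality, so a neighbour of `X` in `M` outside `A₂` belongs to
  -- a₁(M). Its witness in N₁(M) is not `a` itself, since N₁(M) avoids `M`.
  A₁-N1 : ∀ {a} → a ∈ M → NX a → a ∉ A₂ → ∃[ v ] (N1 v × E a v)
  A₁-N1 {a} a∈M nx a∉A₂ with any? (λ v → inN1? G every? v ×-dec E? a v)
  ... | yes found = found
  ... | no none = contradiction (from (A₂-spec a) ((M⇒InA a∈M , noN1) , nx)) a∉A₂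
    where
    noN1 : ∀ v → All G v → v ≡ a ⊎ E a v → ¬ N1 v
    noN1 v _ (inj₁ refl) n1 = N1∉M n1 a∈M
    noN1 v _ (inj₂ Eav) n1 = none (v , n1 , Eav)

  M⇒M₀ : ∀ {v} → v ∈ M → ¬ NX v → v ∈ M₀
  M⇒M₀ v∈M ¬nx = from (M₀-spec _) (inj₁ (inj₁ v∈M , ¬nx ∘ proj₂))

  X⇒M₀ : ∀ {v} → v ∈ X → v ∈ M₀
  X⇒M₀ v∈X = from (M₀-spec _) (inj₁ (inj₂ v∈X , X∉M v∈X ∘ proj₁ ∘ proj₁))

  N1⇒M₀ : ∀ {v a} → N1 v → a ∈ M → NX a → E a v → v ∈ M₀
  N1⇒M₀ n1 a∈M nx Eav = from (M₀-spec _) (inj₂ (n1 , _ , (M⇒InA a∈M , nx) , Eav))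

  data InM₀ (v : Fin n) : Set where
    old  : v ∈ M → ¬ NX v → InM₀ v
    root : v ∈ X → InM₀ v
    new  : ∀ {a x} → N1 v → a ∈ M → x ∈ X → E x a → E a v → InM₀ v

  M₀⇒ : ∀ {v} → v ∈ M₀ → InM₀ v
  M₀⇒ v∈ with to (M₀-spec _) v∈
  ... | inj₁ (inj₁ v∈M , ¬A) = old v∈M (λ nx → ¬A (M⇒InA v∈M , nx))
  ... | inj₁ (inj₂ v∈X , _) = root v∈X
  ... | inj₂ (n1 , a , ((a∈M , _) , x , x∈X , Exa) , Eav) = new n1 a∈M x∈X Exa Eav

  -- Connectedness supplies a path inside `A₂ ∪ X`, and in a tree it must be `p`.
  path-in-A₂∪X : ∀ {r s y p} → r ∈ A₂ ⊎ r ∈ X → s ∈ A₂ ⊎ s ∈ X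
    → PathFromTo G (All G) s r p → y LM.∈ p → y ∈ A₂ ⊎ y ∈ X
  path-in-A₂∪X {r} {s} {y} {p} r∈ s∈ is-path y∈ with connected s r s∈ r∈
  ... | q , walk , rest = walk-member G q walk (subst (y LM.∈_)
          (proj₂ (proj₂ tree) s r p q is-path (walk-restrict G q (λ _ → tt) walk , rest)) y∈)

  T : Fin n → VSet n
  T = Tx G (λ v → v ∈ A₂)

  -- The subtree `T x` and the initial set of Algorithm 1 on it.

  module Component (x : Fin n) (x∈X : x ∈ X) where

    open RootedTree G tree x
    open Cut A₂ public hiding (T)
    open Descent G (T x) T? depth edge-depth parent-unique
    open Algorithm1 x root-depth depth-exists depth-unique public

    x∈T : T x x
    x∈T = root∈T (X∉A₂ x∈X)

    -- If `x′` differed from `x`, the second vertex on its path to `x` would lie in `A₂ ∪ X`. The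
    -- definition of `T x` excludes `A₂`, and independence excludes `X`.
    X∩T : ∀ {x′} → x′ ∈ X → T x x′ → x′ ≡ x
    X∩T {x′} x′∈X t with path x′ | path-is x′ | (λ {a} → T⁻ {x′} {a} t)
      | (λ {y} → path-in-A₂∪X {y = y} (inj₂ x∈X) (inj₂ x′∈X) (path-is x′))
    ... | _ ∷ [] | _ , _ , refl , refl | _ | _ = refl
    ... | _ ∷ y ∷ _ | (_ , Ex′y , _) , _ , refl , _ | avoid | within with within (there (here refl))
    ... | inj₁ y∈A₂ = contradiction y∈A₂ (avoid (there (here refl)))
    ... | inj₂ y∈X = contradiction Ex′y (independent _ _ x′∈X y∈X)

    -- The path from a vertex of A₂ to x stays in A₂ ∪ X, so A₂ is attached to this component only at x.
    A₂-boundary : ∀ {y s} → T x y → s ∈ A₂ → E s y → y ≡ x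
    A₂-boundary {y} {s} t s∈A₂ Esy with edge-path Esy
    ... | inj₂ eq = contradiction s∈A₂ (T⁻ t (subst (s LM.∈_) (sym eq) (there (start-∈-path s))))
    ... | inj₁ eq with path-in-A₂∪X (inj₂ x∈X) (inj₁ s∈A₂) (path-is s)
                         (subst (y LM.∈_) (sym eq) (there (start-∈-path y)))
    ... | inj₁ y∈A₂ = contradiction y∈A₂ (T⇒∉ t)
    ... | inj₂ y∈X = X∩T y∈X t

    neighbour∈T : ∀ {y s} → T x y → y ≢ x → E s y → T x s
    neighbour∈T {y} {s} t y≢x Esy with s ∈? A₂
    ... | yes s∈A₂ = contradiction (A₂-boundary t s∈A₂ Esy) y≢x
    ... | no s∉A₂ = T-closed t (E-sym Esy) s∉A₂

    NX∩T : ∀ {a} → T x a → NX a → E x a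
    NX∩T t (x′ , x′∈X , Ex′a) with X∩T x′∈X (T-closed t (E-sym Ex′a) (X∉A₂ x′∈X))
    ... | refl = Ex′a

    below : ∀ {y} → E x y → depth x < depth y
    below Exy with edge-depth Exy
    ... | inj₂ eq = ℕ.≤-reflexive (sym eq)
    ... | inj₁ eq with trans (sym root-depth) eq
    ... | ()

    triangle-free : ∀ {a b} → E x a → E x b → ¬ E a b
    triangle-free Exa Exb Eab = ℕ.<-asym
      (descend Exa Eab (λ { refl → irrefl x Exb }) (below Exa))
      (descend Exb (E-sym Eab) (λ { refl → irrefl x Exa }) (below Exb))

    s? : Decidable (λ v → (v ∈ M × T x v) ⊎ v ≡ x)
    s? v = ((v ∈? M) ×-dec T? v) ⊎-dec (v ≟ x)

    -- M with x added; exchanging the neighbours of x turns it into M₀ (on T x).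
    S : Subset n
    S = subsetOf s?

    M⇒S : ∀ {v} → v ∈ M → T x v → v ∈ S
    M⇒S v∈M t = ∈-subsetOf⁺ s? (inj₁ (v∈M , t))

    x∈S : x ∈ S
    x∈S = ∈-subsetOf⁺ s? (inj₂ refl)

    S⇒ : ∀ {v} → v ∈ S → v ≢ x → v ∈ M
    S⇒ v∈S v≢x with ∈-subsetOf⁻ s? v∈S
    ... | inj₁ (v∈M , _) = v∈M
    ... | inj₂ eq = contradiction eq v≢x

    N1≢x : ∀ {v} → N1 v → v ≢ x
    N1≢x n1 refl = N1∉X n1 x∈X

    S⊆T : ∀ v → v ∈ S → T x v
    S⊆T v v∈S with ∈-subsetOf⁻ s? v∈S
    ... | inj₁ (_ , t) = t
    ... | inj₂ refl = x∈T

    -- Only `x` can have neighbours in `A₂`, and `x` is in `S`. Every other vertex of `T x` keeps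
    -- its dominator from `M`.
    domS : Dom G (T x) S
    domS = S⊆T , λ v t → let s , s∈S , sv = cover v t in s , s∈S , S⊆T s s∈S , sv
      where
      cover : ∀ v → T x v → ∃[ s ] (s ∈ S × Dominates G s v)
      cover v t with v ≟ x | proj₂ domM v tt
      ... | yes refl | _ = x , x∈S , inj₁ refl
      ... | no v≢x | s , s∈M , _ , inj₁ refl = s , M⇒S s∈M t , inj₁ refl
      ... | no v≢x | s , s∈M , _ , inj₂ Esv = s , M⇒S s∈M (neighbour∈T t v≢x Esv) , inj₂ Esv

    N1-neighbour∈T : ∀ {z w} → T x z → N1 w → E z w → T x w
    N1-neighbour∈T t n1 Ezw = T-closed t Ezw (N1∉M n1 ∘ A₂⊆M)

    -- The root is above all its neighbours. A neighbour `z` of `x` in `S` lies in a₁(M), and its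
    -- N₁-vertex stays private in `S` because there are no triangles, so `z` is not supported. The
    -- remaining case concerns adjacent vertices `z` and `y` of `M`.
    downS : Downward S
    downS z y (z∈S , domz) y∈S Ezy with z ≟ x
    ... | yes refl = below Ezy
    ... | no z≢x with E? x z
    ... | yes Exz with A₁-N1 (S⇒ z∈S z≢x) (x , x∈X , Exz) (T⇒∉ (S⊆T z z∈S))
    ... | w , n1 , Ezw = contradiction domz (private⇒critical G (w , N1-neighbour∈T (S⊆T z z∈S) n1 Ezw , only))
      where
      only : ∀ s → s ∈ S → Dominates G s w → s ≡ z
      only s s∈S sw with s ≟ x | sw
      ... | yes refl | inj₁ refl = contradiction refl (N1≢x n1)
      ... | yes refl | inj₂ Exw = contradiction Ezw (triangle-free Exz Exw)
      ... | no s≢x | inj₁ refl = contradiction (S⇒ s∈S s≢x) (N1∉M n1)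
      ... | no s≢x | inj₂ Esw = adjacent-N1-unique G domM n1 (S⇒ s∈S s≢x) Esw (S⇒ z∈S z≢x) Ezw
    downS z y (z∈S , domz) y∈S Ezy | no z≢x | no ¬Exz
      with S⇒ z∈S z≢x | S⇒ y∈S (λ { refl → ¬Exz (E-sym Ezy) })
    ... | z∈M | y∈M with adjacent-private⇒N1 G domM y∈M z∈M (E-sym Ezy) (privateM z∈M)
    ... | w , n1 , Ezw with proj₂ domz w (N1-neighbour∈T (S⊆T z z∈S) n1 Ezw)
    ... | s , s∈- , _ , sw with s ≟ x | sw
    ... | yes refl | inj₁ refl = contradiction refl (N1≢x n1)
    -- Only the added vertex `x` can have taken the private neighbour `w` from `z`, so `x`, `w`,
    -- `z`, `y` is a descending path.
    ... | yes refl | inj₂ Exw =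
      descend (E-sym Ezw) Ezy (λ { refl → N1∉M n1 y∈M })
        (descend Exw (E-sym Ezw) (z≢x ∘ sym) (below Exw))
    ... | no s≢x | inj₁ refl = contradiction (S⇒ (p─q⊆p S _ s∈-) s≢x) (N1∉M n1)
    ... | no s≢x | inj₂ Esw =
      contradiction (adjacent-N1-unique G domM n1 (S⇒ (p─q⊆p S _ s∈-) s≢x) Esw z∈M Ezw) (x∈p-y⇒x≢y S s∈-)

    module _ {Mx : Subset n} (Mx-spec : ∀ v → v ∈ Mx ⇔ (v ∈ M₀ × T x v)) where

      -- The point is to match N₁ of `M` in the tree with N₁ of `S` in `T x` for neighbours `v` of a
      -- neighbour of `x`. Such a `v` is not adjacent to `x`, by `triangle-free`, and its neighbours
      -- all stay in `T x`, by `neighbour∈T`.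
      next : Next S x Mx
      next v = mk⇔ (λ v∈ → let v∈M₀ , t = to (Mx-spec v) v∈ in forward t (M₀⇒ v∈M₀)) backward
        where
        forward : T x v → InM₀ v → (v ∈ S × ¬ E x v) ⊎ New S x v
        forward t (old v∈M ¬nx) = inj₁ (M⇒S v∈M t , λ Exv → ¬nx (x , x∈X , Exv))
        forward t (root v∈X) with X∩T v∈X t
        ... | refl = inj₁ (x∈S , irrefl x)
        forward t (new {a} {x′} n1 a∈M x′∈X Ex′a Eav) =
          inj₂ ((t , (λ v∈S → N1∉M n1 (S⇒ v∈S (N1≢x n1))) , a , (a∈S , at , Eav) , only) , a , a∈S , Exa , Eav)
          where
          at = neighbour∈T t (N1≢x n1) Eav
          a∈S = M⇒S a∈M at
          Exa = NX∩T at (x′ , x′∈X , Ex′a)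
          only : ∀ s → s ∈ S → T x s → E s v → s ≡ a
          only s s∈S _ Esv with s ≟ x
          ... | yes refl = contradiction Eav (triangle-free Exa Esv)
          ... | no s≢x = adjacent-N1-unique G domM n1 (S⇒ s∈S s≢x) Esv a∈M Eav
        backward : (v ∈ S × ¬ E x v) ⊎ New S x v → v ∈ Mx
        backward (inj₁ (v∈S , ¬Exv)) = from (Mx-spec v) (v∈M₀ , S⊆T v v∈S)
          where
          v∈M₀ : v ∈ M₀
          v∈M₀ with v ≟ x
          ... | yes refl = X⇒M₀ x∈X
          ... | no v≢x = M⇒M₀ (S⇒ v∈S v≢x) (¬Exv ∘ NX∩T (S⊆T v v∈S))
        backward (inj₂ (n1@(t , v∉S , _) , a , a∈S , Exa , Eav)) =
          from (Mx-spec v) (N1⇒M₀ n1M a∈M (x , x∈X , Exa) Eav , t)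
          where
          a∈M = S⇒ a∈S (λ { refl → irrefl x Exa })
          v≢x : v ≢ x
          v≢x refl = v∉S x∈S
          only : ∀ s → s ∈ M → All G s → E s v → s ≡ a
          only s s∈M _ Esv = adjacent-N1-unique G domS n1 (M⇒S s∈M (neighbour∈T t v≢x Esv)) Esv a∈S Eav
          n1M : N1 v
          n1M = tt , (λ v∈M → v∉S (M⇒S v∈M t)) , a , (a∈M , tt , Eav) , only

      good : Good Mx
      good = dom′ , downward′ downS , keep x∈S (irrefl x)
        where open Exchange domS x∈S (λ _ _ → below) next

  -- The path from a common vertex `v` to `x′` avoids `A₂`, so it never leaves `T x`. Then `x′` lies
  -- in `T x`, where `x` is the only vertex of `X`.
  T-disjoint : ∀ {x x′ v} → x ∈ X → x′ ∈ X → T x v → T x′ v → x ≡ x′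
  T-disjoint {x} {x′} {v} x∈X x′∈X t t′ = sym (C.X∩T x′∈X (C.T-walk (path v) (path-is v) (C′.T⁻ t′) t))
    where
    module C = Component x x∈X
    module C′ = Component x′ x′∈X
    open RootedTree G tree x′

  -- `M ∪ X` is injected into `M₀ ∪ A₂`: a neighbour of `X` in `M` goes to itself if it is in `A₂`
  -- and otherwise to a neighbour in N₁(M), and all other vertices go to themselves.
  ∣M∣+∣X∣≤∣M₀∣+∣A₂∣ : ∣ M ∣ + ∣ X ∣ ≤ ∣ M₀ ∣ + ∣ A₂ ∣
  ∣M∣+∣X∣≤∣M₀∣+∣A₂∣ = ℕ.≤-trans (disjoint⇒∣p∣+∣q∣≤∣p∪q∣ M X (λ v v∈M v∈X → X∉M v∈X v∈M))
    (ℕ.≤-trans (injection⇒∣p∣≤∣q∣ (M ∪ X) (M₀ ∪ A₂) R total injective) (∣p∪q∣≤∣p∣+∣q∣ M₀ A₂))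
    where
    R : Fin n → Fin n → Set
    R i j = i ≡ j ⊎ (N1 j × i ∈ M × E i j)
    total : ∀ i → i ∈ M ∪ X → ∃[ j ] (j ∈ M₀ ∪ A₂ × R i j)
    total i i∈ with x∈p∪q⁻ M X i∈
    ... | inj₂ i∈X = i , x∈p∪q⁺ (inj₁ (X⇒M₀ i∈X)) , inj₁ refl
    ... | inj₁ i∈M with nx? i | i ∈? A₂
    ... | no ¬nx | _ = i , x∈p∪q⁺ (inj₁ (M⇒M₀ i∈M ¬nx)) , inj₁ refl
    ... | yes _  | yes i∈A₂ = i , x∈p∪q⁺ (inj₂ i∈A₂) , inj₁ refl
    ... | yes nx | no i∉A₂ with A₁-N1 i∈M nx i∉A₂
    ... | j , n1 , Eij = j , x∈p∪q⁺ (inj₁ (N1⇒M₀ n1 i∈M nx Eij)) , inj₂ (n1 , i∈M , Eij)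
    N1∉M∪X : ∀ {j} → N1 j → j ∉ M ∪ X
    N1∉M∪X n1 j∈ with x∈p∪q⁻ M X j∈
    ... | inj₁ j∈M = N1∉M n1 j∈M
    ... | inj₂ j∈X = N1∉X n1 j∈X
    injective : ∀ {i i′ j} → i ∈ M ∪ X → i′ ∈ M ∪ X → j ∈ M₀ ∪ A₂ → R i j → R i′ j → i ≡ i′
    injective _ _ _ (inj₁ refl) (inj₁ refl) = refl
    injective i∈ _ _ (inj₁ refl) (inj₂ (n1 , _)) = contradiction i∈ (N1∉M∪X n1)
    injective _ i′∈ _ (inj₂ (n1 , _)) (inj₁ refl) = contradiction i′∈ (N1∉M∪X n1)
    injective _ _ _ (inj₂ (n1 , i∈M , e)) (inj₂ (_ , i′∈M , e′)) = adjacent-N1-unique G domM n1 i∈M e i′∈M e′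

  -- The loop of Algorithm 2 and its invariant.

  Processed : Subset n → Fin n → Set
  Processed M′ x = ∃[ S ] (MinDom G (T x) S × x ∈ S × (∀ v → T x v → v ∈ M′ ⇔ v ∈ S))

  Outside : List (Fin n) → Fin n → Set
  Outside xs v = ∀ x → x ∈ X → x LM.∉ xs → ¬ T x v

  -- Here `xs` lists the vertices of `X` still to be treated. `Processed` asks only for agreement on
  -- `T x`, which later iterations, working in disjoint components, leave intact.
  Invariant : List (Fin n) → Subset n → Set
  Invariant xs M′ = (∀ v → Outside xs v → v ∈ M′ ⇔ v ∈ M₀)
                  × (∀ x → x ∈ X → x LM.∉ xs → Processed M′ x)
                  × ∣ M₀ ∣ ≤ ∣ M′ ∣

  module Loop {x xs M′ Mx} (x∈X : x ∈ X) (x∉xs : x LM.∉ xs) (inv : Invariant (x ∷ xs) M′)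
    (Mx-spec : ∀ v → v ∈ Mx ⇔ (v ∈ M′ × T x v)) where

    open Component x x∈X

    outside-T : ∀ {v} → T x v → Outside (x ∷ xs) v
    outside-T t x′ x′∈X x′∉ t′ = x′∉ (here (sym (T-disjoint x∈X x′∈X t t′)))

    -- No earlier iteration has touched `T x`, so `Mx` is still the restriction of `M₀`.
    goodMx : Good Mx
    goodMx = good λ v → mk⇔
      (λ v∈ → let v∈M′ , t = to (Mx-spec v) v∈ in to (proj₁ inv v (outside-T t)) v∈M′ , t)
      (λ { (v∈M₀ , t) → from (Mx-spec v) (from (proj₁ inv v (outside-T t)) v∈M₀ , t) })

    module _ {M″} (out : Out1 G (T x) x Mx M″) where

      private
        result : MinDom G (T x) M″ × x ∈ M″ × ∣ Mx ∣ ≤ ∣ M″ ∣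
        result = out1-spec goodMx out
        M‴ : Subset n
        M‴ = (M′ ─ Mx) ∪ M″

      M″⊆T : ∀ {v} → v ∈ M″ → T x v
      M″⊆T = proj₁ (proj₁ (proj₁ result)) _

      M′─Mx∉T : ∀ {v} → v ∈ M′ ─ Mx → ¬ T x v
      M′─Mx∉T v∈ t = x∈p─q⇒x∉q M′ Mx v∈ (from (Mx-spec _) (p─q⊆p M′ Mx v∈ , t))

      inside⇔ : ∀ {v} → T x v → v ∈ M‴ ⇔ v ∈ M″
      inside⇔ {v} t = mk⇔ forward (x∈p∪q⁺ ∘ inj₂)
        where
        forward : v ∈ M‴ → v ∈ M″
        forward v∈ with x∈p∪q⁻ (M′ ─ Mx) M″ v∈
        ... | inj₁ v∈- = contradiction t (M′─Mx∉T v∈-)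
        ... | inj₂ v∈M″ = v∈M″

      outside⇔ : ∀ {v} → ¬ T x v → v ∈ M‴ ⇔ v ∈ M′
      outside⇔ {v} ¬t = mk⇔ forward
        (λ v∈ → x∈p∪q⁺ (inj₁ (x∈p∧x∉q⇒x∈p─q v∈ (¬t ∘ proj₂ ∘ to (Mx-spec v)))))
        where
        forward : v ∈ M‴ → v ∈ M′
        forward v∈ with x∈p∪q⁻ (M′ ─ Mx) M″ v∈
        ... | inj₁ v∈- = p─q⊆p M′ Mx v∈-
        ... | inj₂ v∈M″ = contradiction (M″⊆T v∈M″) ¬t

      size : ∣ M′ ∣ ≤ ∣ M‴ ∣
      size = begin
        ∣ M′ ∣                ≤⟨ p⊆q⇒∣p∣≤∣q∣ M′⊆ ⟩
        ∣ (M′ ─ Mx) ∪ Mx ∣    ≤⟨ ∣p∪q∣≤∣p∣+∣q∣ (M′ ─ Mx) Mx ⟩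
        ∣ M′ ─ Mx ∣ + ∣ Mx ∣  ≤⟨ ℕ.+-monoʳ-≤ ∣ M′ ─ Mx ∣ (proj₂ (proj₂ result)) ⟩
        ∣ M′ ─ Mx ∣ + ∣ M″ ∣  ≤⟨ disjoint⇒∣p∣+∣q∣≤∣p∪q∣ (M′ ─ Mx) M″ (λ v v∈- → M′─Mx∉T v∈- ∘ M″⊆T) ⟩
        ∣ M‴ ∣                ∎
        where
        open ℕ.≤-Reasoning
        M′⊆ : M′ ⊆ (M′ ─ Mx) ∪ Mx
        M′⊆ {v} v∈ with v ∈? Mx
        ... | yes v∈Mx = x∈p∪q⁺ (inj₂ v∈Mx)
        ... | no v∉Mx = x∈p∪q⁺ (inj₁ (x∈p∧x∉q⇒x∈p─q v∈ v∉Mx))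

      invariant′ : Invariant xs M‴
      invariant′ = unchanged , processed , ℕ.≤-trans (proj₂ (proj₂ inv)) size
        where
        unchanged : ∀ v → Outside xs v → v ∈ M‴ ⇔ v ∈ M₀
        unchanged v v-outside = mk⇔ (to old⇔ ∘ to keep⇔) (from keep⇔ ∘ from old⇔)
          where
          keep⇔ = outside⇔ (v-outside x x∈X x∉xs)
          old⇔ = proj₁ inv v (λ x′ x′∈X x′∉ → v-outside x′ x′∈X (x′∉ ∘ there))
        processed : ∀ x′ → x′ ∈ X → x′ LM.∉ xs → Processed M‴ x′
        processed x′ x′∈X x′∉ with x′ ≟ x
        ... | yes refl = M″ , proj₁ result , proj₁ (proj₂ result) , λ v → inside⇔
        ... | no x′≢x with proj₁ (proj₂ inv) x′ x′∈X (λ { (here eq) → x′≢x eq ; (there x′∈) → x′∉ x′∈ })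
        ... | S , min , x′∈S , same = S , min , x′∈S , λ v t →
          let keep⇔ = outside⇔ (λ t′ → x′≢x (T-disjoint x′∈X x∈X t t′)) in
          mk⇔ (to (same v t) ∘ to keep⇔) (from keep⇔ ∘ from (same v t))

  halts2 : ∀ xs {M′} → Unique xs → (∀ {x} → x LM.∈ xs → x ∈ X) → Invariant xs M′
    → Halts2 G (λ v → v ∈ A₂) M′ xs
  halts2 [] _ _ _ = tt
  halts2 (x ∷ xs) (x≢ ∷ uniq) xs⊆X inv Mx Mx-spec =
    Component.halts1 x x∈X L.goodMx , λ M″ out → halts2 xs uniq (xs⊆X ∘ there) (L.invariant′ out)
    where
    x∈X = xs⊆X (here refl)
    module L = Loop x∈X (λ x∈xs → All-lookup x≢ x∈xs refl) inv Mx-spec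

  out2-invariant : ∀ xs {M′ Mout} → Unique xs → (∀ {x} → x LM.∈ xs → x ∈ X) → Invariant xs M′
    → Out2 G (λ v → v ∈ A₂) M′ xs Mout → Invariant [] Mout
  out2-invariant [] _ _ inv fin = inv
  out2-invariant (x ∷ xs) (x≢ ∷ uniq) xs⊆X inv (iter Mx-spec out rest) =
    out2-invariant xs uniq (xs⊆X ∘ there)
      (Loop.invariant′ (xs⊆X (here refl)) (λ x∈xs → All-lookup x≢ x∈xs refl) inv Mx-spec out) rest

  -- Domination, minimality and size of the output.

  module Final {M′ : Subset n} (inv : Invariant [] M′) where

    Rest : Fin n → Set
    Rest v = ∀ x → x ∈ X → ¬ T x v

    region : ∀ v → (∃[ x ] (x ∈ X × T x v)) ⊎ Rest v
    region v with any? (λ x → (x ∈? X) ×-dec RootedTree.Cut.T? G tree x A₂ v)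
    ... | yes found = inj₁ found
    ... | no none = inj₂ λ x x∈X t → none (x , x∈X , t)

    rest⇔ : ∀ {v} → Rest v → v ∈ M′ ⇔ v ∈ M₀
    rest⇔ rest = proj₁ inv _ (λ x x∈X _ → rest x x∈X)

    processed : ∀ x → x ∈ X → Processed M′ x
    processed x x∈X = proj₁ (proj₂ inv) x x∈X (λ ())

    closed : ∀ {x u v} → T x u → E u v → v ∉ A₂ → T x v
    closed {x} = RootedTree.Cut.T-closed G tree x A₂

    X⇒T : ∀ {x} → x ∈ X → T x x
    X⇒T {x} = Component.x∈T x

    rest-neighbour : ∀ {v s} → Rest v → v ∉ A₂ → E s v → Rest s
    rest-neighbour rest v∉A₂ Esv x x∈X t = rest x x∈X (closed t Esv v∉A₂)

    rest-¬NX : ∀ {v} → Rest v → v ∉ A₂ → ¬ NX v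
    rest-¬NX rest v∉A₂ (x , x∈X , Exv) = rest x x∈X (closed (X⇒T x∈X) Exv v∉A₂)

    A₂⇒rest : ∀ {v} → v ∈ A₂ → Rest v
    A₂⇒rest v∈A₂ x x∈X t = Component.T⇒∉ x x∈X t v∈A₂

    -- The vertices added to `M` lie in components: a new `v` is reached from `x` through some `a`
    -- that has an N₁-neighbour and so is not in `A₂`.
    M′∩rest⊆M : ∀ {v} → Rest v → v ∈ M′ → v ∈ M
    M′∩rest⊆M rest v∈M′ with M₀⇒ (to (rest⇔ rest) v∈M′)
    ... | old v∈M _ = v∈M
    ... | root v∈X = contradiction (X⇒T v∈X) (rest _ v∈X)
    ... | new n1 a∈M x∈X Exa Eav = contradiction
      (closed (closed (X⇒T x∈X) Exa (λ a∈A₂ → A₂≁N1 a∈A₂ Eav n1)) Eav (N1∉M n1 ∘ A₂⊆M)) (rest _ x∈X)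

    A₂∉M′ : ∀ {v} → v ∈ A₂ → v ∉ M′
    A₂∉M′ v∈A₂ v∈M′ with M₀⇒ (to (rest⇔ (A₂⇒rest v∈A₂)) v∈M′)
    ... | old _ ¬nx = ¬nx (A₂⊆NX v∈A₂)
    ... | root v∈X = X∉A₂ v∈X v∈A₂
    ... | new n1 _ _ _ _ = N1∉M n1 (A₂⊆M v∈A₂)

    rest-M⇒M′ : ∀ {v} → Rest v → v ∉ A₂ → v ∈ M → v ∈ M′
    rest-M⇒M′ rest v∉A₂ v∈M = from (rest⇔ rest) (M⇒M₀ v∈M (rest-¬NX rest v∉A₂))

    -- Otherwise `s`, `w`, `s′` is the path between two vertices of `A₂`, which forces `w` into `A₂`
    -- or into `X`, hence into its own component.
    two-A₂-neighbours : ∀ {w s s′} → Rest w → w ∉ A₂ → s ∈ A₂ → s′ ∈ A₂ → s ≢ s′ → E s w → ¬ E s′ w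
    two-A₂-neighbours {w} {s} {s′} rest w∉A₂ s∈A₂ s′∈A₂ s≢s′ Esw Es′w
      with path-in-A₂∪X (inj₁ s′∈A₂) (inj₁ s∈A₂) is-path (there (here refl))
      where
      is-path : PathFromTo G (All G) s s′ (s ∷ w ∷ s′ ∷ [])
      is-path = cons-path G Esw tt
        (λ { (here refl) → irrefl s Esw ; (there (here eq)) → s≢s′ eq })
        (cons-path G (E-sym Es′w) tt (λ { (here refl) → irrefl w Es′w }) (tt , [] ∷ [] , refl , refl))
    ... | inj₁ w∈A₂ = w∉A₂ w∈A₂
    ... | inj₂ w∈X = rest w w∈X (X⇒T w∈X)

    -- Outside the components only `A₂` is lost from `M`. If all neighbours of `w` in `M` were in
    -- `A₂`, there would be just one, so `w` would be in N₁(M), although a vertex of a₂(M) has no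
    -- neighbour there.
    cover-rest : ∀ w → Rest w → w ∉ A₂ → ∃[ s ] (s ∈ M′ × Dominates G s w)
    cover-rest w rest w∉A₂ with proj₂ domM w tt
    ... | s , s∈M , _ , inj₁ refl = s , rest-M⇒M′ rest w∉A₂ s∈M , inj₁ refl
    ... | s , s∈M , _ , inj₂ Esw with w ∈? M | any? (λ s → (s ∈? M) ×-dec (¬? (s ∈? A₂) ×-dec E? s w))
    ... | yes w∈M | _ = w , rest-M⇒M′ rest w∉A₂ w∈M , inj₁ refl
    ... | no _ | yes (t , t∈M , t∉A₂ , Etw) = t , rest-M⇒M′ (rest-neighbour rest w∉A₂ Etw) t∉A₂ t∈M , inj₂ Etw
    ... | no w∉M | no none = contradiction (tt , w∉M , s , (s∈M , tt , Esw) , only) (A₂≁N1 (in-A₂ s∈M Esw) Esw)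
      where
      in-A₂ : ∀ {t} → t ∈ M → E t w → t ∈ A₂
      in-A₂ {t} t∈M Etw with t ∈? A₂
      ... | yes t∈A₂ = t∈A₂
      ... | no t∉A₂ = contradiction (t , t∈M , t∉A₂ , Etw) none
      only : ∀ t → t ∈ M → All G t → E t w → t ≡ s
      only t t∈M _ Etw with t ≟ s
      ... | yes eq = eq
      ... | no t≢s = contradiction Esw (two-A₂-neighbours rest w∉A₂ (in-A₂ t∈M Etw) (in-A₂ s∈M Esw) t≢s Etw)

    cover : ∀ w → ∃[ s ] (s ∈ M′ × Dominates G s w)
    cover w with region w
    ... | inj₁ (x , x∈X , t) with processed x x∈X
    ... | _ , ((_ , coverS) , _) , _ , same with coverS w t
    ... | s , s∈S , ts , sw = s , from (same s ts) s∈S , sw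
    cover w | inj₂ rest with w ∈? A₂
    ... | no w∉A₂ = cover-rest w rest w∉A₂
    -- A vertex of `A₂` is dominated by an adjacent root, which Algorithm 1 has kept.
    ... | yes w∈A₂ with A₂⊆NX w∈A₂
    ... | x , x∈X , Exw with processed x x∈X
    ... | _ , _ , x∈S , same = x , from (same x (X⇒T x∈X)) x∈S , inj₂ Exw

    -- M′ avoids A₂, which separates the components, so private neighbours inside a component stay private.
    private-in-T : ∀ {x u} → x ∈ X → T x u → u ∈ M′ → Private G (All G) M′ u
    private-in-T {x} {u} x∈X t u∈M′ with processed x x∈X
    ... | S , min , _ , same with minDom⇒private G (Component.T? x x∈X) min u (to (same u t) u∈M′)
    ... | w , tw , only = w , tt , only′
      where
      only′ : ∀ s → s ∈ M′ → Dominates G s w → s ≡ u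
      only′ s s∈M′ (inj₁ refl) = only s (to (same s tw) s∈M′) (inj₁ refl)
      only′ s s∈M′ (inj₂ Esw) = only s (to (same s (closed tw (E-sym Esw) (λ s∈A₂ → A₂∉M′ s∈A₂ s∈M′))) s∈M′) (inj₂ Esw)

    -- The private neighbour `w` that `u` has for `M` still works: neither `u` nor `w` is in `A₂`,
    -- so `w` and all its neighbours lie outside the components, where `M′` is contained in `M`.
    private-in-rest : ∀ {u} → Rest u → u ∈ M′ → Private G (All G) M′ u
    private-in-rest {u} rest u∈M′ with privateM (M′∩rest⊆M rest u∈M′)
    ... | w , _ , only with proj₂ domM w tt
    ... | s , s∈M , _ , sw with only s s∈M sw
    ... | refl = w , tt , only′
      where
      u∉A₂ : u ∉ A₂
      u∉A₂ u∈A₂ = A₂∉M′ u∈A₂ u∈M′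
      w∉A₂ : w ∉ A₂
      w∉A₂ w∈A₂ = u∉A₂ (subst (_∈ A₂) (only w (A₂⊆M w∈A₂) (inj₁ refl)) w∈A₂)
      dominated-rest : Dominates G u w → Rest w
      dominated-rest (inj₁ refl) = rest
      dominated-rest (inj₂ Euw) = rest-neighbour rest u∉A₂ (E-sym Euw)
      rest-w : Rest w
      rest-w = dominated-rest sw
      rest-s : ∀ {s} → Dominates G s w → Rest s
      rest-s (inj₁ refl) = rest-w
      rest-s (inj₂ Esw) = rest-neighbour rest-w w∉A₂ Esw
      only′ : ∀ s → s ∈ M′ → Dominates G s w → s ≡ u
      only′ s s∈M′ sw′ = only s (M′∩rest⊆M (rest-s sw′) s∈M′) sw′

    minDom : MinDom G (All G) M′
    minDom = privates⇒minDom G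
      ((λ _ _ → tt) , λ w _ → let s , s∈M′ , sw = cover w in s , s∈M′ , tt , sw)
      private-in
      where
      private-in : ∀ u → u ∈ M′ → Private G (All G) M′ u
      private-in u u∈M′ with region u
      ... | inj₁ (x , x∈X , t) = private-in-T x∈X t u∈M′
      ... | inj₂ rest = private-in-rest rest u∈M′

    size : ∣ M ∣ ∸ ∣ A₂ ∣ + ∣ X ∣ ≤ ∣ M′ ∣
    size = begin
      -- Since `A₂ ⊆ M`, the truncated subtraction is an exact one and commutes with the addition.
      ∣ M ∣ ∸ ∣ A₂ ∣ + ∣ X ∣    ≡⟨ ℕ.+-∸-comm ∣ X ∣ (p⊆q⇒∣p∣≤∣q∣ A₂⊆M) ⟨
      ∣ M ∣ + ∣ X ∣ ∸ ∣ A₂ ∣    ≤⟨ ℕ.∸-monoˡ-≤ ∣ A₂ ∣ ∣M∣+∣X∣≤∣M₀∣+∣A₂∣ ⟩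
      ∣ M₀ ∣ + ∣ A₂ ∣ ∸ ∣ A₂ ∣  ≡⟨ ℕ.m+n∸n≡m ∣ M₀ ∣ ∣ A₂ ∣ ⟩
      ∣ M₀ ∣                    ≤⟨ proj₂ (proj₂ inv) ⟩
      ∣ M′ ∣                    ∎
      where open ℕ.≤-Reasoning

theorem12 : ∀ {n} (G : Graph n) → IsTree G (All G)
    → (M : Subset n) → MinDom G (All G) M
    → (X : Subset n) → (∀ x → x ∈ X → InN2 G (All G) M x)
    → (∀ x y → x ∈ X → y ∈ X → ¬ Graph.E G x y)
    → (A₂ : Subset n)
    → (∀ v → v ∈ A₂ ⇔ (InA2 G (All G) M v × ∃[ x ] (x ∈ X × Graph.E G x v)))
    → Connected G (λ v → v ∈ A₂ ⊎ v ∈ X)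
    → (M₀ : Subset n)
    → (∀ v → v ∈ M₀ ⇔
         (((v ∈ M ⊎ v ∈ X)
            × ¬ (InA G (All G) M v × (∃[ x ] (x ∈ X × Graph.E G x v))))
         ⊎ (InN1 G (All G) M v
            × ∃[ a ] ((InA G (All G) M a × ∃[ x ] (x ∈ X × Graph.E G x a))
                      × Graph.E G a v))))
    → (xs : List (Fin n)) → Unique xs → (∀ v → v ∈ X ⇔ v LM.∈ xs)
    → Halts2 G (λ v → v ∈ A₂) M₀ xs
      × (∀ M' → Out2 G (λ v → v ∈ A₂) M₀ xs M'
           → MinDom G (All G) M' × ∣ M ∣ ∸ ∣ A₂ ∣ + ∣ X ∣ ≤ ∣ M' ∣)
theorem12 G tree M minM X X⊆N2 independent A₂ A₂-spec connected M₀ M₀-spec xs uniq X⇔xs =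
  halts2 xs uniq xs⊆X start , λ M′ out →
    let inv = out2-invariant xs uniq xs⊆X start out in Final.minDom inv , Final.size inv
  where
  open Algorithm2 G tree M minM X X⊆N2 independent A₂ A₂-spec connected M₀ M₀-spec
  xs⊆X : ∀ {x} → x LM.∈ xs → x ∈ X
  xs⊆X = from (X⇔xs _)
  start : Invariant xs M₀
  start = (λ _ _ → mk⇔ id id) , (λ x x∈X x∉xs → contradiction (to (X⇔xs x) x∈X) x∉xs) , ℕ.≤-refl
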